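{- Let $\mathcal{A}$ be a category which has all small limits and colimits, has stable monomorphisms, and in which every epimorphism splits. Let $D:\mathcal{D}\to\mathrm{Monad}(\mathcal{A})$ be a small diagram having a weakly terminal object, i.e. an object $j$ of $\mathcal{D}$ such that for every object $i$ of $\mathcal{D}$ there exists a morphism $i\to j$ in $\mathcal{D}$. Then $D$ has a colimit in $\mathrm{Monad}(\mathcal{A})$. In particular, $\mathrm{Monad}(\mathcal{A})$ has coequalizers.
   Context: A cocomplete category has stable monomorphisms if (a) coproducts of set-indexed families of monomorphisms are monomorphisms, and (b) colimit cocones of chains of monomorphisms consist of monomorphisms, and the factorizing morphism induced by any cocone of monomorphisms from such a chain is a monomorphism. $\mathrm{Monad}(\mathcal{A})$ is the category of monads and monad morphisms. -}

module Defs where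

open import Level using (Level; _⊔_) renaming (suc to lsuc)
open import Relation.Binary using (Rel; IsEquivalence; Setoid; IsStrictTotalOrder)
open import Relation.Binary.PropositionalEquality using (_≡_)
import Relation.Binary.PropositionalEquality as P
open import Induction.WellFounded using (WellFounded)
open import Data.Product using (Σ; _,_; proj₁; proj₂; _×_)
open import Data.Sum using (_⊎_; inj₁; inj₂)
open import Data.Unit.Polymorphic using (⊤; tt)
import Relation.Binary.Reasoning.Setoid as SetoidR

record Category (o ℓ e : Level) : Set (lsuc (o ⊔ ℓ ⊔ e)) where
  infixr 9 _∘_
  infix 4 _≈_
  field
    Obj : Set o
    _⇒_ : Obj → Obj → Set ℓ
    _≈_ : ∀ {A B} → Rel (A ⇒ B) e
    id : ∀ {A} → A ⇒ A
    _∘_ : ∀ {A B C} → B ⇒ C → A ⇒ B → A ⇒ C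
    equiv : ∀ {A B} → IsEquivalence (_≈_ {A} {B})
    assoc : ∀ {A B C D} {f : A ⇒ B} {g : B ⇒ C} {h : C ⇒ D} →
            (h ∘ g) ∘ f ≈ h ∘ (g ∘ f)
    identityˡ : ∀ {A B} {f : A ⇒ B} → id ∘ f ≈ f
    identityʳ : ∀ {A B} {f : A ⇒ B} → f ∘ id ≈ f
    ∘-resp-≈ : ∀ {A B C} {f h : B ⇒ C} {g i : A ⇒ B} →
               f ≈ h → g ≈ i → f ∘ g ≈ h ∘ i

  hom-setoid : ∀ {A B} → Setoid ℓ e
  hom-setoid {A} {B} = record { Carrier = A ⇒ B ; _≈_ = _≈_ ; isEquivalence = equiv }

  module _ {A B : Obj} where
    open IsEquivalence (equiv {A} {B}) public
      renaming (refl to ≈-refl; sym to ≈-sym; trans to ≈-trans)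

infix 10 _[_,_]
_[_,_] : ∀ {o ℓ e} (C : Category o ℓ e) → Category.Obj C → Category.Obj C → Set ℓ
C [ A , B ] = Category._⇒_ C A B

record Functor {o ℓ e o′ ℓ′ e′} (C : Category o ℓ e) (D : Category o′ ℓ′ e′)
       : Set (o ⊔ ℓ ⊔ e ⊔ o′ ⊔ ℓ′ ⊔ e′) where
  private
    module C = Category C
    module D = Category D
  field
    F₀ : C.Obj → D.Obj
    F₁ : ∀ {A B} → C [ A , B ] → D [ F₀ A , F₀ B ]
    identity : ∀ {A} → F₁ (C.id {A}) D.≈ D.id
    homomorphism : ∀ {X Y Z} {f : C [ X , Y ]} {g : C [ Y , Z ]} →
                   F₁ (g C.∘ f) D.≈ F₁ g D.∘ F₁ f
    F-resp-≈ : ∀ {A B} {f g : C [ A , B ]} → f C.≈ g → F₁ f D.≈ F₁ g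

idF : ∀ {o ℓ e} {C : Category o ℓ e} → Functor C C
idF {C = C} = record
  { F₀ = λ X → X ; F₁ = λ f → f ; identity = ≈-refl
  ; homomorphism = ≈-refl ; F-resp-≈ = λ p → p }
  where open Category C

infixr 9 _∘F_
_∘F_ : ∀ {o ℓ e} {C : Category o ℓ e} → Functor C C → Functor C C → Functor C C
_∘F_ {C = C} G F = record
  { F₀ = λ X → G.F₀ (F.F₀ X)
  ; F₁ = λ f → G.F₁ (F.F₁ f)
  ; identity = ≈-trans (G.F-resp-≈ F.identity) G.identity
  ; homomorphism = ≈-trans (G.F-resp-≈ F.homomorphism) G.homomorphism
  ; F-resp-≈ = λ p → G.F-resp-≈ (F.F-resp-≈ p) }
  where
    open Category C
    module G = Functor G
    module F = Functor F

record NatTrans {o ℓ e o′ ℓ′ e′} {C : Category o ℓ e} {D : Category o′ ℓ′ e′}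
       (F G : Functor C D) : Set (o ⊔ ℓ ⊔ ℓ′ ⊔ e′) where
  private
    module C = Category C
    module D = Category D
    module F = Functor F
    module G = Functor G
  field
    η : ∀ X → D [ F.F₀ X , G.F₀ X ]
    commute : ∀ {X Y} (f : C [ X , Y ]) → η Y D.∘ F.F₁ f D.≈ G.F₁ f D.∘ η X

record Monad {o ℓ e} (C : Category o ℓ e) : Set (o ⊔ ℓ ⊔ e) where
  open Category C
  field
    F : Functor C C
    unit : NatTrans idF F
    mult : NatTrans (F ∘F F) F
  open Functor F public
  module unit = NatTrans unit
  module mult = NatTrans mult
  field
    assoc′ : ∀ X → mult.η X ∘ F₁ (mult.η X) ≈ mult.η X ∘ mult.η (F₀ X)
    identityˡ′ : ∀ X → mult.η X ∘ F₁ (unit.η X) ≈ id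
    identityʳ′ : ∀ X → mult.η X ∘ unit.η (F₀ X) ≈ id

record MonadMorphism {o ℓ e} {C : Category o ℓ e} (S T : Monad C) : Set (o ⊔ ℓ ⊔ e) where
  open Category C
  private
    module S = Monad S
    module T = Monad T
  field
    σ : NatTrans S.F T.F
  open NatTrans σ public
  field
    unit-law : ∀ X → η X ∘ S.unit.η X ≈ T.unit.η X
    mult-law : ∀ X → η X ∘ S.mult.η X ≈ T.mult.η X ∘ (T.F₁ (η X) ∘ η (S.F₀ X))

MonadCat : ∀ {o ℓ e} → Category o ℓ e → Category (o ⊔ ℓ ⊔ e) (o ⊔ ℓ ⊔ e) (o ⊔ e)
MonadCat {o} {ℓ} {e} C = record
  { Obj = Monad C
  ; _⇒_ = MonadMorphism
  ; _≈_ = λ σ τ → ∀ X → MonadMorphism.η σ X ≈ MonadMorphism.η τ X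
  ; id = idM
  ; _∘_ = compM
  ; equiv = record
      { refl = λ X → ≈-refl
      ; sym = λ p X → ≈-sym (p X)
      ; trans = λ p q X → ≈-trans (p X) (q X) }
  ; assoc = λ X → assoc
  ; identityˡ = λ X → identityˡ
  ; identityʳ = λ X → identityʳ
  ; ∘-resp-≈ = λ p q X → ∘-resp-≈ (p X) (q X)
  }
  where
  open Category C

  idM : ∀ {S} → MonadMorphism S S
  idM {S} = record
    { σ = record
        { η = λ X → id
        ; commute = λ f → ≈-trans identityˡ (≈-sym identityʳ) }
    ; unit-law = λ X → identityˡ
    ; mult-law = λ X → ≈-trans identityˡ
        (≈-sym (≈-trans (∘-resp-≈ ≈-refl (≈-trans identityʳ S.identity)) identityʳ))
    }
    where module S = Monad S

  compM : ∀ {S T U} → MonadMorphism T U → MonadMorphism S T → MonadMorphism S U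
  compM {S} {T} {U} τ σ = record
    { σ = record { η = ρ ; commute = comm }
    ; unit-law = ul
    ; mult-law = ml
    }
    where
    module S = Monad S
    module T = Monad T
    module U = Monad U
    module τ = MonadMorphism τ
    module σ = MonadMorphism σ
    ρ : ∀ X → S.F₀ X ⇒ U.F₀ X
    ρ X = τ.η X ∘ σ.η X
    comm : ∀ {X Y} (f : X ⇒ Y) → ρ Y ∘ S.F₁ f ≈ U.F₁ f ∘ ρ X
    comm {X} {Y} f = begin
            (τ.η Y ∘ σ.η Y) ∘ S.F₁ f ≈⟨ assoc ⟩
            τ.η Y ∘ (σ.η Y ∘ S.F₁ f) ≈⟨ ∘-resp-≈ ≈-refl (σ.commute f) ⟩
            τ.η Y ∘ (T.F₁ f ∘ σ.η X) ≈⟨ ≈-sym assoc ⟩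
            (τ.η Y ∘ T.F₁ f) ∘ σ.η X ≈⟨ ∘-resp-≈ (τ.commute f) ≈-refl ⟩
            (U.F₁ f ∘ τ.η X) ∘ σ.η X ≈⟨ assoc ⟩
            U.F₁ f ∘ (τ.η X ∘ σ.η X) ∎
      where open SetoidR (hom-setoid {S.F₀ X} {U.F₀ Y})
    ul : ∀ X → ρ X ∘ S.unit.η X ≈ U.unit.η X
    ul X = begin
        (τ.η X ∘ σ.η X) ∘ S.unit.η X ≈⟨ assoc ⟩
        τ.η X ∘ (σ.η X ∘ S.unit.η X) ≈⟨ ∘-resp-≈ ≈-refl (σ.unit-law X) ⟩
        τ.η X ∘ T.unit.η X ≈⟨ τ.unit-law X ⟩
        U.unit.η X ∎
      where open SetoidR (hom-setoid {X} {U.F₀ X})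
    mid : ∀ X → (U.F₁ (τ.η X) ∘ τ.η (T.F₀ X)) ∘ (T.F₁ (σ.η X) ∘ σ.η (S.F₀ X))
                ≈ U.F₁ (τ.η X ∘ σ.η X) ∘ (τ.η (S.F₀ X) ∘ σ.η (S.F₀ X))
    mid X = begin
      (U.F₁ (τ.η X) ∘ τ.η (T.F₀ X)) ∘ (T.F₁ (σ.η X) ∘ σ.η (S.F₀ X)) ≈⟨ assoc ⟩
      U.F₁ (τ.η X) ∘ (τ.η (T.F₀ X) ∘ (T.F₁ (σ.η X) ∘ σ.η (S.F₀ X)))
        ≈⟨ ∘-resp-≈ ≈-refl (≈-sym assoc) ⟩
      U.F₁ (τ.η X) ∘ ((τ.η (T.F₀ X) ∘ T.F₁ (σ.η X)) ∘ σ.η (S.F₀ X))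
        ≈⟨ ∘-resp-≈ ≈-refl (∘-resp-≈ (τ.commute (σ.η X)) ≈-refl) ⟩
      U.F₁ (τ.η X) ∘ ((U.F₁ (σ.η X) ∘ τ.η (S.F₀ X)) ∘ σ.η (S.F₀ X))
        ≈⟨ ∘-resp-≈ ≈-refl assoc ⟩
      U.F₁ (τ.η X) ∘ (U.F₁ (σ.η X) ∘ (τ.η (S.F₀ X) ∘ σ.η (S.F₀ X))) ≈⟨ ≈-sym assoc ⟩
      (U.F₁ (τ.η X) ∘ U.F₁ (σ.η X)) ∘ (τ.η (S.F₀ X) ∘ σ.η (S.F₀ X))
        ≈⟨ ∘-resp-≈ (≈-sym U.homomorphism) ≈-refl ⟩
      U.F₁ (τ.η X ∘ σ.η X) ∘ (τ.η (S.F₀ X) ∘ σ.η (S.F₀ X)) ∎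
      where open SetoidR (hom-setoid {S.F₀ (S.F₀ X)} {U.F₀ (U.F₀ X)})
    ml : ∀ X → ρ X ∘ S.mult.η X ≈ U.mult.η X ∘ (U.F₁ (ρ X) ∘ ρ (S.F₀ X))
    ml X = begin
        (τ.η X ∘ σ.η X) ∘ S.mult.η X ≈⟨ assoc ⟩
        τ.η X ∘ (σ.η X ∘ S.mult.η X) ≈⟨ ∘-resp-≈ ≈-refl (σ.mult-law X) ⟩
        τ.η X ∘ (T.mult.η X ∘ (T.F₁ (σ.η X) ∘ σ.η (S.F₀ X))) ≈⟨ ≈-sym assoc ⟩
        (τ.η X ∘ T.mult.η X) ∘ (T.F₁ (σ.η X) ∘ σ.η (S.F₀ X))
          ≈⟨ ∘-resp-≈ (τ.mult-law X) ≈-refl ⟩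
        (U.mult.η X ∘ (U.F₁ (τ.η X) ∘ τ.η (T.F₀ X))) ∘ (T.F₁ (σ.η X) ∘ σ.η (S.F₀ X))
          ≈⟨ assoc ⟩
        U.mult.η X ∘ ((U.F₁ (τ.η X) ∘ τ.η (T.F₀ X)) ∘ (T.F₁ (σ.η X) ∘ σ.η (S.F₀ X)))
          ≈⟨ ∘-resp-≈ ≈-refl (mid X) ⟩
        U.mult.η X ∘ (U.F₁ (τ.η X ∘ σ.η X) ∘ (τ.η (S.F₀ X) ∘ σ.η (S.F₀ X))) ∎
      where open SetoidR (hom-setoid {S.F₀ (S.F₀ X)} {U.F₀ X})

module _ {o ℓ e o′ ℓ′ e′} {J : Category o′ ℓ′ e′} {C : Category o ℓ e} (F : Functor J C) where
  private
    module J = Category J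
    module F = Functor F
  open Category C

  record Cocone : Set (o ⊔ ℓ ⊔ e ⊔ o′ ⊔ ℓ′) where
    field
      N : Obj
      ψ : ∀ j → F.F₀ j ⇒ N
      commute : ∀ {i j} (f : J [ i , j ]) → ψ j ∘ F.F₁ f ≈ ψ i

  record Colimit : Set (o ⊔ ℓ ⊔ e ⊔ o′ ⊔ ℓ′) where
    field
      cocone : Cocone
    open Cocone cocone public
    field
      rep : (K : Cocone) → N ⇒ Cocone.N K
      rep-commute : (K : Cocone) → ∀ j → rep K ∘ ψ j ≈ Cocone.ψ K j
      rep-unique : (K : Cocone) (u : N ⇒ Cocone.N K) →
                   (∀ j → u ∘ ψ j ≈ Cocone.ψ K j) → u ≈ rep K

  record Cone : Set (o ⊔ ℓ ⊔ e ⊔ o′ ⊔ ℓ′) where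
    field
      N : Obj
      ψ : ∀ j → N ⇒ F.F₀ j
      commute : ∀ {i j} (f : J [ i , j ]) → F.F₁ f ∘ ψ i ≈ ψ j

  record Limit : Set (o ⊔ ℓ ⊔ e ⊔ o′ ⊔ ℓ′) where
    field
      cone : Cone
    open Cone cone public
    field
      rep : (K : Cone) → Cone.N K ⇒ N
      rep-commute : (K : Cone) → ∀ j → ψ j ∘ rep K ≈ Cone.ψ K j
      rep-unique : (K : Cone) (u : Cone.N K ⇒ N) →
                   (∀ j → ψ j ∘ u ≈ Cone.ψ K j) → u ≈ rep K

module _ {o ℓ e} (C : Category o ℓ e) where
  open Category C

  Mono : ∀ {A B} → A ⇒ B → Set (o ⊔ ℓ ⊔ e)
  Mono {A} f = ∀ {Z} (g h : Z ⇒ A) → f ∘ g ≈ f ∘ h → g ≈ h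

  Epi : ∀ {A B} → A ⇒ B → Set (o ⊔ ℓ ⊔ e)
  Epi {B = B} f = ∀ {Z} (g h : B ⇒ Z) → g ∘ f ≈ h ∘ f → g ≈ h

  SplitEpi : ∀ {A B} → A ⇒ B → Set (ℓ ⊔ e)
  SplitEpi {A} {B} f = Σ (B ⇒ A) λ s → f ∘ s ≈ id

  record Coproduct {i} {I : Set i} (X : I → Obj) : Set (o ⊔ ℓ ⊔ e ⊔ i) where
    field
      obj : Obj
      ι : ∀ k → X k ⇒ obj
      [_] : ∀ {Z} → (∀ k → X k ⇒ Z) → obj ⇒ Z
      inject : ∀ {Z} (f : ∀ k → X k ⇒ Z) k → [ f ] ∘ ι k ≈ f k
      unique : ∀ {Z} (f : ∀ k → X k ⇒ Z) (u : obj ⇒ Z) →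
               (∀ k → u ∘ ι k ≈ f k) → u ≈ [ f ]

  record Coequalizer {A B} (f g : A ⇒ B) : Set (o ⊔ ℓ ⊔ e) where
    field
      obj : Obj
      arr : B ⇒ obj
      equality : arr ∘ f ≈ arr ∘ g
      coequalize : ∀ {Z} (h : B ⇒ Z) → h ∘ f ≈ h ∘ g → obj ⇒ Z
      universal : ∀ {Z} (h : B ⇒ Z) (eq : h ∘ f ≈ h ∘ g) → coequalize h eq ∘ arr ≈ h
      unique : ∀ {Z} (h : B ⇒ Z) (eq : h ∘ f ≈ h ∘ g) (u : obj ⇒ Z) →
               u ∘ arr ≈ h → u ≈ coequalize h eq

record WellOrder (s : Level) : Set (lsuc s) where
  field
    Carrier : Set s
    _<_ : Rel Carrier s
    isStrictTotalOrder : IsStrictTotalOrder _≡_ _<_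
    wellFounded : WellFounded _<_
  open IsStrictTotalOrder isStrictTotalOrder public using (trans)

  _≤_ : Rel Carrier s
  i ≤ j = i < j ⊎ i ≡ j

  ≤-trans : ∀ {i j k} → i ≤ j → j ≤ k → i ≤ k
  ≤-trans (inj₁ p) (inj₁ q) = inj₁ (trans p q)
  ≤-trans (inj₁ p) (inj₂ P.refl) = inj₁ p
  ≤-trans (inj₂ P.refl) q = q

ChainShape : ∀ {s} → WellOrder s → Category s s s
ChainShape W = record
  { Obj = Carrier
  ; _⇒_ = _≤_
  ; _≈_ = λ _ _ → ⊤
  ; id = inj₂ P.refl
  ; _∘_ = λ q p → ≤-trans p q
  ; equiv = record { refl = tt ; sym = λ _ → tt ; trans = λ _ _ → tt }
  ; assoc = tt ; identityˡ = tt ; identityʳ = tt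
  ; ∘-resp-≈ = λ _ _ → tt }
  where open WellOrder W

record StableMonos (s : Level) {o ℓ e} (C : Category o ℓ e)
       : Set (lsuc s ⊔ o ⊔ ℓ ⊔ e) where
  open Category C
  field
    coproduct-mono :
      ∀ {I : Set s} {X Y : I → Obj} (f : ∀ k → X k ⇒ Y k) →
      (∀ k → Mono C (f k)) →
      (P : Coproduct C X) (Q : Coproduct C Y) →
      Mono C (Coproduct.[_] P (λ k → Coproduct.ι Q k ∘ f k))
    chain-colimit-mono :
      ∀ (W : WellOrder s) (H : Functor (ChainShape W) C) →
      (∀ {i j} (p : ChainShape W [ i , j ]) → Mono C (Functor.F₁ H p)) →
      (L : Colimit H) → ∀ j → Mono C (Colimit.ψ L j)
    chain-factor-mono :
      ∀ (W : WellOrder s) (H : Functor (ChainShape W) C) →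
      (∀ {i j} (p : ChainShape W [ i , j ]) → Mono C (Functor.F₁ H p)) →
      (L : Colimit H) (K : Cocone H) → (∀ j → Mono C (Cocone.ψ K j)) →
      Mono C (Colimit.rep L K)

WeaklyTerminal : ∀ {o ℓ e} (J : Category o ℓ e) → Category.Obj J → Set (o ⊔ ℓ)
WeaklyTerminal J j = ∀ i → J [ i , j ]

{-# OPTIONS --safe #-}

-- Since every epimorphism splits, a quotient of X is an endomorphism of X, so X has only a small
-- set of quotients.  Let T be the monad at the weakly terminal object; the colimit is the
-- universal monad quotient R of T identifying all parallel pairs φ, ψ of connecting morphisms into
-- T.  A quotient algebra of the free T-algebra T X satisfying these equations is encoded by an
-- endomorphism k of T X with k μ = k μ (T k) and k μ φ = k μ ψ.  R X is the joint image of all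
-- such k, and it is the reflection of T X in the algebras satisfying the equations, because the
-- image of every homomorphism from T X to such an algebra is one of the quotients considered.
module Submission where

open import Level using (Level; _⊔_)
open import Data.Maybe using (Maybe; just; nothing)
open import Data.Product using (Σ; _×_; _,_; proj₁; proj₂)
open import Data.Unit.Polymorphic using (⊤; tt)
open import Relation.Binary.PropositionalEquality using (_≡_; refl)
import Relation.Binary.PropositionalEquality as P
import Relation.Binary.Reasoning.Setoid as SetoidR
open import Defs

-- Joint coequalizers and joint images.

module _ {o ℓ e} (C : Category o ℓ e) where
  open Category C

  -- The pairs keep separate sources, so the notion makes sense for monads without first forming a
  -- coproduct of the `Z i`.
  record JointCoequalizer {i} {I : Set i} {Z : I → Obj} {X : Obj} (g h : ∀ i → Z i ⇒ X)
         : Set (o ⊔ ℓ ⊔ e ⊔ i) where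
    field
      obj : Obj
      arr : X ⇒ obj
      equality : ∀ i → arr ∘ g i ≈ arr ∘ h i
      coequalize : ∀ {Y} (k : X ⇒ Y) → (∀ i → k ∘ g i ≈ k ∘ h i) → obj ⇒ Y
      universal : ∀ {Y} (k : X ⇒ Y) (eq : ∀ i → k ∘ g i ≈ k ∘ h i) → coequalize k eq ∘ arr ≈ k
      unique : ∀ {Y} (k : X ⇒ Y) (eq : ∀ i → k ∘ g i ≈ k ∘ h i) (u : obj ⇒ Y) →
               u ∘ arr ≈ k → u ≈ coequalize k eq

    arr-epi : Epi C arr
    arr-epi u v eq = ≈-trans (unique (v ∘ arr) eqs u eq) (≈-sym (unique (v ∘ arr) eqs v ≈-refl))
      where
      eqs : ∀ i → (v ∘ arr) ∘ g i ≈ (v ∘ arr) ∘ h i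
      eqs i = ≈-trans assoc (≈-trans (∘-resp-≈ ≈-refl (equality i)) (≈-sym assoc))

  -- This is the image of the tupling of all `f i`, with no product formed. By `absorb` and
  -- `separate`, `q` identifies exactly those pairs that every `f i` identifies.
  record JointImage {i} {I : Set i} {X : Obj} {Y : I → Obj} (f : ∀ i → X ⇒ Y i)
         : Set (o ⊔ ℓ ⊔ e ⊔ i) where
    field
      obj : Obj
      q : X ⇒ obj
      s : obj ⇒ X
      retract : q ∘ s ≈ id
      absorb : ∀ i → f i ∘ (s ∘ q) ≈ f i
      separate : ∀ {Z} (u v : Z ⇒ X) → (∀ i → f i ∘ u ≈ f i ∘ v) → q ∘ u ≈ q ∘ v

-- Rewriting composites and cancelling split epimorphisms.

module Composition {o ℓ e} (C : Category o ℓ e) where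
  open Category C

  module HomReasoning {X Y} = SetoidR (hom-setoid {X} {Y})
  open HomReasoning

  infixr 4 refl⟩∘⟨_
  infixl 5 _⟩∘⟨refl

  refl⟩∘⟨_ : ∀ {X Y Z} {f : Y ⇒ Z} {g h : X ⇒ Y} → g ≈ h → f ∘ g ≈ f ∘ h
  refl⟩∘⟨ p = ∘-resp-≈ ≈-refl p

  _⟩∘⟨refl : ∀ {X Y Z} {f g : Y ⇒ Z} {h : X ⇒ Y} → f ≈ g → f ∘ h ≈ g ∘ h
  p ⟩∘⟨refl = ∘-resp-≈ p ≈-refl

  pullˡ : ∀ {W X Y Z} {f : Y ⇒ Z} {g : X ⇒ Y} {k : X ⇒ Z} {h : W ⇒ X} →
          f ∘ g ≈ k → f ∘ (g ∘ h) ≈ k ∘ h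
  pullˡ p = ≈-trans (≈-sym assoc) (p ⟩∘⟨refl)

  pullʳ : ∀ {W X Y Z} {f : Y ⇒ Z} {g : X ⇒ Y} {h : W ⇒ X} {k : W ⇒ Y} →
          g ∘ h ≈ k → (f ∘ g) ∘ h ≈ f ∘ k
  pullʳ p = ≈-trans assoc (refl⟩∘⟨ p)

  extendʳ : ∀ {V W X Y Z} {f : Y ⇒ Z} {g : X ⇒ Y} {f′ : W ⇒ Z} {g′ : X ⇒ W} {h : V ⇒ X} →
            f ∘ g ≈ f′ ∘ g′ → f ∘ (g ∘ h) ≈ f′ ∘ (g′ ∘ h)
  extendʳ p = ≈-trans (pullˡ p) assoc

  cancel-split : ∀ {X Y Z} {q : X ⇒ Y} {s : Y ⇒ X} {g h : Y ⇒ Z} →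
                 q ∘ s ≈ id → g ∘ q ≈ h ∘ q → g ≈ h
  cancel-split {q = q} {s} {g} {h} qs p = begin
    g           ≈⟨ identityʳ ⟨
    g ∘ id      ≈⟨ refl⟩∘⟨ qs ⟨
    g ∘ (q ∘ s) ≈⟨ extendʳ p ⟩
    h ∘ (q ∘ s) ≈⟨ refl⟩∘⟨ qs ⟩
    h ∘ id      ≈⟨ identityʳ ⟩
    h           ∎

  -- Splittings, unlike epimorphisms in general, survive every functor. Quotient maps therefore
  -- remain cancellable after applying a monad.
  map-split : (F : Functor C C) → let open Functor F in
              ∀ {X Y} {q : X ⇒ Y} {s : Y ⇒ X} → q ∘ s ≈ id → F₁ q ∘ F₁ s ≈ id
  map-split F qs = ≈-trans (≈-sym homomorphism) (≈-trans (F-resp-≈ qs) identity)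
    where open Functor F

-- Joint coequalizers as colimits.

module JointCoequalizerShape {a} (I : Set a) where

  -- `nothing` is the common target and `just i` the source of the `i`-th pair. No two non-identity
  -- arrows are composable.
  data Hom : Maybe I → Maybe I → Set a where
    idh : ∀ {x} → Hom x x
    left right : ∀ {i} → Hom (just i) nothing

  compose : ∀ {x y z} → Hom y z → Hom x y → Hom x z
  compose idh f = f
  compose left idh = left
  compose right idh = right

  compose-idʳ : ∀ {x y} (f : Hom x y) → compose f idh ≡ f
  compose-idʳ idh = refl
  compose-idʳ left = refl
  compose-idʳ right = refl

  compose-assoc : ∀ {w x y z} (f : Hom w x) (g : Hom x y) (h : Hom y z) →
                  compose (compose h g) f ≡ compose h (compose g f)
  compose-assoc f g idh = refl
  compose-assoc f idh left = refl
  compose-assoc f idh right = refl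

  shape : Category a a a
  shape = record
    { Obj = Maybe I
    ; _⇒_ = Hom
    ; _≈_ = _≡_
    ; id = idh
    ; _∘_ = compose
    ; equiv = P.isEquivalence
    ; assoc = λ {_ _ _ _ f g h} → compose-assoc f g h
    ; identityˡ = refl
    ; identityʳ = λ {_ _ f} → compose-idʳ f
    ; ∘-resp-≈ = P.cong₂ compose }

  module _ {o ℓ e} (C : Category o ℓ e) where
    open Category C

    module _ {Z : I → Obj} {X : Obj} (g h : ∀ i → Z i ⇒ X) where

      diagram : Functor shape C
      diagram = record
        { F₀ = F₀ ; F₁ = F₁ ; identity = ≈-refl
        ; homomorphism = λ {_ _ _ f k} → hom f k
        ; F-resp-≈ = λ { refl → ≈-refl } }
        where
        F₀ : Maybe I → Obj
        F₀ (just i) = Z i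
        F₀ nothing = X
        F₁ : ∀ {x y} → Hom x y → F₀ x ⇒ F₀ y
        F₁ idh = id
        F₁ (left {i}) = g i
        F₁ (right {i}) = h i
        hom : ∀ {x y z} (f : Hom x y) (k : Hom y z) → F₁ (compose k f) ≈ F₁ k ∘ F₁ f
        hom f idh = ≈-sym identityˡ
        hom idh left = ≈-sym identityʳ
        hom idh right = ≈-sym identityʳ

      colimit⇒jointCoequalizer : Colimit diagram → JointCoequalizer C g h
      colimit⇒jointCoequalizer L = record
        { obj = N
        ; arr = ψ nothing
        ; equality = λ i → ≈-trans (commute left) (≈-sym (commute right))
        ; coequalize = λ k eq → rep (fork k eq)
        ; universal = λ k eq → rep-commute (fork k eq) nothing
        ; unique = λ k eq u p → rep-unique (fork k eq) u (λ
            { (just i) → ≈-trans (∘-resp-≈ ≈-refl (≈-sym (commute left)))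
                                 (≈-trans (≈-sym assoc) (∘-resp-≈ p ≈-refl))
            ; nothing → p }) }
        where
        open Colimit L
        fork : ∀ {Y} (k : X ⇒ Y) → (∀ i → k ∘ g i ≈ k ∘ h i) → Cocone diagram
        fork k eq = record
          { N = _
          ; ψ = λ { (just i) → k ∘ g i ; nothing → k }
          ; commute = λ
            { idh → identityʳ
            ; left → ≈-refl
            ; right → ≈-sym (eq _) } }

-- Joint images from coequalizers and split epimorphisms.

module Images {o ℓ e a} (A : Category o ℓ e)
  (coeq : ∀ {I : Set (ℓ ⊔ e ⊔ a)} {Z : I → Category.Obj A} {X : Category.Obj A}
          (g h : ∀ i → A [ Z i , X ]) → JointCoequalizer A g h)
  (split : ∀ {X Y : Category.Obj A} (f : A [ X , Y ]) → Epi A f → SplitEpi A f) where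

  open Category A
  open Composition A

  -- The quotient by all endomorphisms t with f t = f.  It separates: if f u = f v, then f also
  -- factors through the coequalizer c of q u and q v; splitting c q gives another such t, which q
  -- absorbs, so c is invertible.
  jointImage : ∀ {I : Set a} {X} {Y : I → Obj} (f : ∀ i → X ⇒ Y i) → JointImage A f
  jointImage {I} {X} {Y} f = record
    { obj = Q.obj ; q = q ; s = s ; retract = qs ; absorb = absorb ; separate = separate }
    where
    -- Endomorphisms of `X` form a small set, so one joint coequalizer handles all of them.
    Absorbed : Set (ℓ ⊔ e ⊔ a)
    Absorbed = Σ (X ⇒ X) λ t → ∀ i → f i ∘ t ≈ f i
    module Q = JointCoequalizer (coeq {Absorbed} proj₁ (λ _ → id))
    q = Q.arr
    s = proj₁ (split q Q.arr-epi)
    qs : q ∘ s ≈ id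
    qs = proj₂ (split q Q.arr-epi)
    f-eq : ∀ i (t : Absorbed) → f i ∘ proj₁ t ≈ f i ∘ id
    f-eq i (_ , p) = ≈-trans (p i) (≈-sym identityʳ)
    f̄ : ∀ i → Q.obj ⇒ Y i
    f̄ i = Q.coequalize (f i) (f-eq i)
    f̄q : ∀ i → f̄ i ∘ q ≈ f i
    f̄q i = Q.universal (f i) (f-eq i)
    absorb : ∀ i → f i ∘ (s ∘ q) ≈ f i
    absorb i = begin
      f i ∘ (s ∘ q)         ≈⟨ f̄q i ⟩∘⟨refl ⟨
      (f̄ i ∘ q) ∘ (s ∘ q)   ≈⟨ pullʳ (pullˡ qs) ⟩
      f̄ i ∘ (id ∘ q)        ≈⟨ refl⟩∘⟨ identityˡ ⟩
      f̄ i ∘ q               ≈⟨ f̄q i ⟩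
      f i                   ∎
      where open HomReasoning
    separate : ∀ {Z} (u v : Z ⇒ X) → (∀ i → f i ∘ u ≈ f i ∘ v) → q ∘ u ≈ q ∘ v
    separate {Z} u v eq = begin
      q ∘ u               ≈⟨ identityˡ ⟨
      id ∘ (q ∘ u)        ≈⟨ qtc ⟩∘⟨refl ⟨
      ((q ∘ t) ∘ c) ∘ (q ∘ u) ≈⟨ pullʳ (R.equality tt) ⟩
      (q ∘ t) ∘ (c ∘ (q ∘ v)) ≈⟨ assoc ⟨
      ((q ∘ t) ∘ c) ∘ (q ∘ v) ≈⟨ qtc ⟩∘⟨refl ⟩
      id ∘ (q ∘ v)        ≈⟨ identityˡ ⟩
      q ∘ v               ∎
      where
      open HomReasoning
      module R = JointCoequalizer (coeq {⊤} (λ _ → q ∘ u) (λ _ → q ∘ v))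
      c = R.arr
      cq-epi : Epi A (c ∘ q)
      cq-epi g h p = R.arr-epi g h (Q.arr-epi _ _ (≈-trans assoc (≈-trans p (≈-sym assoc))))
      t = proj₁ (split (c ∘ q) cq-epi)
      cqt : (c ∘ q) ∘ t ≈ id
      cqt = proj₂ (split (c ∘ q) cq-epi)
      f̄-eq : ∀ i (_ : ⊤) → f̄ i ∘ (q ∘ u) ≈ f̄ i ∘ (q ∘ v)
      f̄-eq i _ = ≈-trans (pullˡ (f̄q i)) (≈-trans (eq i) (≈-sym (pullˡ (f̄q i))))
      f̂ : ∀ i → R.obj ⇒ Y i
      f̂ i = R.coequalize (f̄ i) (f̄-eq i)
      f̂cq : ∀ i → f̂ i ∘ (c ∘ q) ≈ f i
      f̂cq i = ≈-trans (pullˡ (R.universal (f̄ i) (f̄-eq i))) (f̄q i)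
      tcq-absorbed : ∀ i → f i ∘ (t ∘ (c ∘ q)) ≈ f i
      tcq-absorbed i = begin
        f i ∘ (t ∘ (c ∘ q))               ≈⟨ f̂cq i ⟩∘⟨refl ⟨
        (f̂ i ∘ (c ∘ q)) ∘ (t ∘ (c ∘ q))   ≈⟨ pullʳ (pullˡ cqt) ⟩
        f̂ i ∘ (id ∘ (c ∘ q))              ≈⟨ refl⟩∘⟨ identityˡ ⟩
        f̂ i ∘ (c ∘ q)                     ≈⟨ f̂cq i ⟩
        f i                               ∎
      qtc : (q ∘ t) ∘ c ≈ id
      qtc = Q.arr-epi _ _ (begin
        ((q ∘ t) ∘ c) ∘ q   ≈⟨ ≈-trans assoc assoc ⟩
        q ∘ (t ∘ (c ∘ q))   ≈⟨ Q.equality (_ , tcq-absorbed) ⟩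
        q ∘ id              ≈⟨ identityʳ ⟩
        q                   ≈⟨ identityˡ ⟨
        id ∘ q              ∎)

-- Monad structure on a pointwise split quotient of a monad.

module _ {o ℓ e} {A : Category o ℓ e} (T : Monad A) where
  open Category A
  open Composition A
  private module T = Monad T

  -- The sections `s` are chosen objectwise, with no naturality. As `q` is cancellable, `R₁-q` and
  -- `m-q` determine `R₁` and `m`, and the monad laws descend from `T`.
  record PointwiseQuotient : Set (o ⊔ ℓ ⊔ e) where
    field
      R₀ : Obj → Obj
      q : ∀ X → T.F₀ X ⇒ R₀ X
      s : ∀ X → R₀ X ⇒ T.F₀ X
      retract : ∀ X → q X ∘ s X ≈ id
      R₁ : ∀ {X Y} → X ⇒ Y → R₀ X ⇒ R₀ Y
      R₁-q : ∀ {X Y} (f : X ⇒ Y) → R₁ f ∘ q X ≈ q Y ∘ T.F₁ f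
      m : ∀ X → R₀ (R₀ X) ⇒ R₀ X
      m-q : ∀ X → m X ∘ (q (R₀ X) ∘ T.F₁ (q X)) ≈ q X ∘ T.mult.η X

    q-cancel : ∀ {X Y} {f g : R₀ X ⇒ Y} → f ∘ q X ≈ g ∘ q X → f ≈ g
    q-cancel = cancel-split (retract _)

    qTq-cancel : ∀ {X Y} {f g : R₀ (R₀ X) ⇒ Y} →
                 f ∘ (q (R₀ X) ∘ T.F₁ (q X)) ≈ g ∘ (q (R₀ X) ∘ T.F₁ (q X)) → f ≈ g
    qTq-cancel p = q-cancel (cancel-split (map-split T.F (retract _))
                     (≈-trans assoc (≈-trans p (≈-sym assoc))))

    R : Functor A A
    R = record
      { F₀ = R₀
      ; F₁ = R₁
      ; identity = q-cancel (begin
          R₁ id ∘ q _    ≈⟨ R₁-q id ⟩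
          q _ ∘ T.F₁ id  ≈⟨ refl⟩∘⟨ T.identity ⟩
          q _ ∘ id       ≈⟨ identityʳ ⟩
          q _            ≈⟨ identityˡ ⟨
          id ∘ q _       ∎)
      ; homomorphism = λ {_ _ _ f g} → q-cancel (begin
          R₁ (g ∘ f) ∘ q _          ≈⟨ R₁-q (g ∘ f) ⟩
          q _ ∘ T.F₁ (g ∘ f)        ≈⟨ refl⟩∘⟨ T.homomorphism ⟩
          q _ ∘ (T.F₁ g ∘ T.F₁ f)   ≈⟨ extendʳ (R₁-q g) ⟨
          R₁ g ∘ (q _ ∘ T.F₁ f)     ≈⟨ refl⟩∘⟨ R₁-q f ⟨
          R₁ g ∘ (R₁ f ∘ q _)       ≈⟨ assoc ⟨
          (R₁ g ∘ R₁ f) ∘ q _       ∎)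
      ; F-resp-≈ = λ {_ _ f g} p → q-cancel (begin
          R₁ f ∘ q _     ≈⟨ R₁-q f ⟩
          q _ ∘ T.F₁ f   ≈⟨ refl⟩∘⟨ T.F-resp-≈ p ⟩
          q _ ∘ T.F₁ g   ≈⟨ R₁-q g ⟨
          R₁ g ∘ q _     ∎) }
      where open HomReasoning

    quotientMonad : Monad A
    quotientMonad = record
      { F = R
      ; unit = record
          { η = λ X → q X ∘ T.unit.η X
          ; commute = λ f → begin
              (q _ ∘ T.unit.η _) ∘ f         ≈⟨ pullʳ (T.unit.commute f) ⟩
              q _ ∘ (T.F₁ f ∘ T.unit.η _)    ≈⟨ extendʳ (R₁-q f) ⟨
              R₁ f ∘ (q _ ∘ T.unit.η _)      ∎ }
      ; mult = record { η = m ; commute = m-natural }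
      ; assoc′ = m-assoc
      ; identityˡ′ = λ X → q-cancel (begin
          (m X ∘ R₁ (q X ∘ T.unit.η X)) ∘ q _
            ≈⟨ pullʳ (R₁-q _) ⟩
          m X ∘ (q _ ∘ T.F₁ (q X ∘ T.unit.η X))
            ≈⟨ refl⟩∘⟨ refl⟩∘⟨ T.homomorphism ⟩
          m X ∘ (q _ ∘ (T.F₁ (q X) ∘ T.F₁ (T.unit.η X)))
            ≈⟨ refl⟩∘⟨ assoc ⟨
          m X ∘ ((q _ ∘ T.F₁ (q X)) ∘ T.F₁ (T.unit.η X))
            ≈⟨ extendʳ (m-q X) ⟩
          q X ∘ (T.mult.η X ∘ T.F₁ (T.unit.η X))
            ≈⟨ refl⟩∘⟨ T.identityˡ′ X ⟩
          q X ∘ id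
            ≈⟨ ≈-trans identityʳ (≈-sym identityˡ) ⟩
          id ∘ q X ∎)
      ; identityʳ′ = λ X → q-cancel (begin
          (m X ∘ (q _ ∘ T.unit.η _)) ∘ q X
            ≈⟨ pullʳ (pullʳ (T.unit.commute (q X))) ⟩
          m X ∘ (q _ ∘ (T.F₁ (q X) ∘ T.unit.η _))
            ≈⟨ refl⟩∘⟨ assoc ⟨
          m X ∘ ((q _ ∘ T.F₁ (q X)) ∘ T.unit.η _)
            ≈⟨ extendʳ (m-q X) ⟩
          q X ∘ (T.mult.η X ∘ T.unit.η _)
            ≈⟨ refl⟩∘⟨ T.identityʳ′ X ⟩
          q X ∘ id
            ≈⟨ ≈-trans identityʳ (≈-sym identityˡ) ⟩
          id ∘ q X ∎) }
      where
      open HomReasoning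

      m-natural : ∀ {X Y} (f : X ⇒ Y) → m Y ∘ R₁ (R₁ f) ≈ R₁ f ∘ m X
      m-natural {X} {Y} f = qTq-cancel (begin
        (m Y ∘ R₁ (R₁ f)) ∘ (q _ ∘ T.F₁ (q X))
          ≈⟨ pullʳ (extendʳ (R₁-q (R₁ f))) ⟩
        m Y ∘ (q _ ∘ (T.F₁ (R₁ f) ∘ T.F₁ (q X)))
          ≈⟨ refl⟩∘⟨ refl⟩∘⟨ ≈-trans (≈-sym T.homomorphism)
               (≈-trans (T.F-resp-≈ (R₁-q f)) T.homomorphism) ⟩
        m Y ∘ (q _ ∘ (T.F₁ (q Y) ∘ T.F₁ (T.F₁ f)))
          ≈⟨ refl⟩∘⟨ assoc ⟨
        m Y ∘ ((q _ ∘ T.F₁ (q Y)) ∘ T.F₁ (T.F₁ f))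
          ≈⟨ extendʳ (m-q Y) ⟩
        q Y ∘ (T.mult.η Y ∘ T.F₁ (T.F₁ f))
          ≈⟨ refl⟩∘⟨ T.mult.commute f ⟩
        q Y ∘ (T.F₁ f ∘ T.mult.η X)
          ≈⟨ extendʳ (R₁-q f) ⟨
        R₁ f ∘ (q X ∘ T.mult.η X)
          ≈⟨ pullʳ (m-q X) ⟨
        (R₁ f ∘ m X) ∘ (q _ ∘ T.F₁ (q X)) ∎)

      m-assoc : ∀ X → m X ∘ R₁ (m X) ≈ m X ∘ m (R₀ X)
      -- The source is a threefold application of `R`, so the law is tested on `T` applied three
      -- times; the extra cancellation removes `T.F₁ (T.F₁ (q X))`.
      m-assoc X = qTq-cancel (cancel-split (map-split T.F (map-split T.F (retract X))) (begin
        ((m X ∘ R₁ (m X)) ∘ (q _ ∘ T.F₁ (q _))) ∘ T.F₁ (T.F₁ (q X))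
          ≈⟨ pullʳ (pullʳ (≈-sym T.homomorphism)) ⟩
        (m X ∘ R₁ (m X)) ∘ (q _ ∘ T.F₁ (q _ ∘ T.F₁ (q X)))
          ≈⟨ pullʳ (extendʳ (R₁-q (m X))) ⟩
        m X ∘ (q _ ∘ (T.F₁ (m X) ∘ T.F₁ (q _ ∘ T.F₁ (q X))))
          ≈⟨ refl⟩∘⟨ refl⟩∘⟨ ≈-trans (≈-sym T.homomorphism)
               (≈-trans (T.F-resp-≈ (m-q X)) T.homomorphism) ⟩
        m X ∘ (q _ ∘ (T.F₁ (q X) ∘ T.F₁ (T.mult.η X)))
          ≈⟨ refl⟩∘⟨ assoc ⟨
        m X ∘ ((q _ ∘ T.F₁ (q X)) ∘ T.F₁ (T.mult.η X))
          ≈⟨ extendʳ (m-q X) ⟩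
        q X ∘ (T.mult.η X ∘ T.F₁ (T.mult.η X))
          ≈⟨ refl⟩∘⟨ T.assoc′ X ⟩
        q X ∘ (T.mult.η X ∘ T.mult.η _)
          ≈⟨ extendʳ (m-q X) ⟨
        m X ∘ ((q _ ∘ T.F₁ (q X)) ∘ T.mult.η _)
          ≈⟨ refl⟩∘⟨ pullʳ (≈-sym (T.mult.commute (q X))) ⟩
        m X ∘ (q _ ∘ (T.mult.η _ ∘ T.F₁ (T.F₁ (q X))))
          ≈⟨ refl⟩∘⟨ extendʳ (m-q (R₀ X)) ⟨
        m X ∘ (m _ ∘ ((q _ ∘ T.F₁ (q _)) ∘ T.F₁ (T.F₁ (q X))))
          ≈⟨ ≈-trans assoc assoc ⟨
        ((m X ∘ m _) ∘ (q _ ∘ T.F₁ (q _))) ∘ T.F₁ (T.F₁ (q X)) ∎))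

    projection : MonadMorphism T quotientMonad
    projection = record
      { σ = record { η = q ; commute = λ f → ≈-sym (R₁-q f) }
      ; unit-law = λ X → ≈-refl
      ; mult-law = λ X → ≈-trans (≈-sym (m-q X)) (refl⟩∘⟨ ≈-sym (R₁-q (q X))) }

    -- Naturality and the multiplication law turn into those of `τ` after precomposition with `q` or
    -- `q ∘ T.F₁ q`, which cancel. Objectwise factorizations are thus enough.
    factorization : ∀ {U : Monad A} (τ : MonadMorphism T U) (t : ∀ X → R₀ X ⇒ Monad.F₀ U X) →
                    (∀ X → t X ∘ q X ≈ MonadMorphism.η τ X) → MonadMorphism quotientMonad U
    factorization {U} τ t tq = record
      { σ = record
          { η = t
          ; commute = λ f → q-cancel (begin
              (t _ ∘ R₁ f) ∘ q _       ≈⟨ pullʳ (R₁-q f) ⟩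
              t _ ∘ (q _ ∘ T.F₁ f)     ≈⟨ pullˡ (tq _) ⟩
              τ.η _ ∘ T.F₁ f           ≈⟨ τ.commute f ⟩
              U.F₁ f ∘ τ.η _           ≈⟨ pullʳ (tq _) ⟨
              (U.F₁ f ∘ t _) ∘ q _     ∎) }
      ; unit-law = λ X → ≈-trans (pullˡ (tq X)) (τ.unit-law X)
      ; mult-law = λ X → qTq-cancel (begin
          (t X ∘ m X) ∘ (q _ ∘ T.F₁ (q X))
            ≈⟨ pullʳ (m-q X) ⟩
          t X ∘ (q X ∘ T.mult.η X)
            ≈⟨ pullˡ (tq X) ⟩
          τ.η X ∘ T.mult.η X
            ≈⟨ τ.mult-law X ⟩
          U.mult.η X ∘ (U.F₁ (τ.η X) ∘ τ.η _)
            ≈⟨ refl⟩∘⟨ (≈-trans (U.F-resp-≈ (≈-sym (tq X))) U.homomorphism ⟩∘⟨refl) ⟩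
          U.mult.η X ∘ ((U.F₁ (t X) ∘ U.F₁ (q X)) ∘ τ.η _)
            ≈⟨ refl⟩∘⟨ pullʳ (≈-sym (τ.commute (q X))) ⟩
          U.mult.η X ∘ (U.F₁ (t X) ∘ (τ.η _ ∘ T.F₁ (q X)))
            ≈⟨ refl⟩∘⟨ refl⟩∘⟨ pullˡ (tq _) ⟨
          U.mult.η X ∘ (U.F₁ (t X) ∘ (t _ ∘ (q _ ∘ T.F₁ (q X))))
            ≈⟨ pullʳ assoc ⟨
          (U.mult.η X ∘ (U.F₁ (t X) ∘ t _)) ∘ (q _ ∘ T.F₁ (q X)) ∎) }
      where
      module U = Monad U
      module τ = MonadMorphism τ
      open HomReasoning

-- Joint coequalizers of monad morphisms.

module MonadCoequalizers {o ℓ e} (A : Category o ℓ e)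
  (image : ∀ {I : Set (ℓ ⊔ e)} {X : Category.Obj A} {Y : I → Category.Obj A}
           (f : ∀ i → A [ X , Y i ]) → JointImage A f)
  {I : Set (ℓ ⊔ e)} {S : I → Monad A} {T : Monad A} (φ ψ : ∀ i → MonadMorphism (S i) T) where

  open Category A
  open Composition A
  private
    module S i = Monad (S i)
    module T = Monad T
    module φ i = MonadMorphism (φ i)
    module ψ i = MonadMorphism (ψ i)
    open HomReasoning

  -- Idempotence of k follows by precomposing mult-compat with the unit.
  record Congruence (X : Obj) : Set (ℓ ⊔ e) where
    field
      k : T.F₀ X ⇒ T.F₀ X
      mult-compat : k ∘ T.mult.η X ≈ k ∘ (T.mult.η X ∘ T.F₁ k)
      identifies : ∀ i → k ∘ (T.mult.η X ∘ φ.η i (T.F₀ X)) ≈ k ∘ (T.mult.η X ∘ ψ.η i (T.F₀ X))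

  open Congruence

  -- `Congruence X` is a small set, so all congruences together can index one joint image; its
  -- kernel is the intersection of theirs.
  module Universal (X : Obj) = JointImage (image (k {X}))
  open Universal renaming (obj to R₀)

  -- The restrictions of `b` along `φ i` and `ψ i` agree: this singles out the algebras of the
  -- quotient monad among the `T`-algebras.
  Equational : ∀ {B} → T.F₀ B ⇒ B → Set (ℓ ⊔ e)
  Equational {B} b = ∀ i → b ∘ φ.η i B ≈ b ∘ ψ.η i B

  -- The idempotent of the image of `f` serves: by `separateᶠ`, equations after `qᶠ` may be checked
  -- after `f`, where `f-hom` moves them into `B`. Thus homomorphisms into arbitrary codomains are
  -- controlled by a small set.
  kernelCongruence : ∀ {X B} (b : T.F₀ B ⇒ B) (f : T.F₀ X ⇒ B) →
                     f ∘ T.mult.η X ≈ b ∘ T.F₁ f → Equational b →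
                     Σ (Congruence X) λ c → f ∘ k c ≈ f
  kernelCongruence {X} {B} b f f-hom b-eq = record
    { k = sᶠ ∘ qᶠ
    ; mult-compat = ≈-trans (pullʳ (separateᶠ _ _ λ _ → begin
        f ∘ T.mult.η X                       ≈⟨ f-hom ⟩
        b ∘ T.F₁ f                           ≈⟨ refl⟩∘⟨ T.F-resp-≈ f-absorb ⟨
        b ∘ T.F₁ (f ∘ (sᶠ ∘ qᶠ))             ≈⟨ refl⟩∘⟨ T.homomorphism ⟩
        b ∘ (T.F₁ f ∘ T.F₁ (sᶠ ∘ qᶠ))        ≈⟨ extendʳ f-hom ⟨
        f ∘ (T.mult.η X ∘ T.F₁ (sᶠ ∘ qᶠ))    ∎)) (≈-sym assoc)
    ; identifies = λ i → ≈-trans (pullʳ (separateᶠ _ _ λ _ → begin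
        f ∘ (T.mult.η X ∘ φ.η i _)   ≈⟨ extendʳ f-hom ⟩
        b ∘ (T.F₁ f ∘ φ.η i _)       ≈⟨ refl⟩∘⟨ φ.commute i f ⟨
        b ∘ (φ.η i _ ∘ S.F₁ i f)     ≈⟨ extendʳ (b-eq i) ⟩
        b ∘ (ψ.η i _ ∘ S.F₁ i f)     ≈⟨ refl⟩∘⟨ ψ.commute i f ⟩
        b ∘ (T.F₁ f ∘ ψ.η i _)       ≈⟨ extendʳ f-hom ⟨
        f ∘ (T.mult.η X ∘ ψ.η i _)   ∎)) (≈-sym assoc) }
    , f-absorb
    where
    open JointImage (image {⊤} (λ _ → f))
      renaming (q to qᶠ; s to sᶠ; absorb to absorbᶠ; separate to separateᶠ)
    f-absorb : f ∘ (sᶠ ∘ qᶠ) ≈ f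
    f-absorb = absorbᶠ tt

  -- The kernel congruence of `f` is one of those that define `q X`, so `f` factors through its `k`,
  -- and `k` through `q X`. This is the existence half of the reflection.
  hom-absorb : ∀ {X B} (b : T.F₀ B ⇒ B) (f : T.F₀ X ⇒ B) →
               f ∘ T.mult.η X ≈ b ∘ T.F₁ f → Equational b → f ∘ (s X ∘ q X) ≈ f
  hom-absorb {X} b f f-hom b-eq with kernelCongruence b f f-hom b-eq
  ... | c , fk = begin
    f ∘ (s X ∘ q X)           ≈⟨ fk ⟩∘⟨refl ⟨
    (f ∘ k c) ∘ (s X ∘ q X)   ≈⟨ pullʳ (absorb X c) ⟩
    f ∘ k c                   ≈⟨ fk ⟩
    f                         ∎

  act : ∀ X → T.F₀ (R₀ X) ⇒ R₀ X
  act X = q X ∘ (T.mult.η X ∘ T.F₁ (s X))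

  -- By `separate` it suffices to compare after each `k c`. There `mult-compat` inserts
  -- `T.F₁ (k c)`, which absorbs `s X ∘ q X`. The choice of section in `act` thus does not matter.
  act-q : ∀ X → act X ∘ T.F₁ (q X) ≈ q X ∘ T.mult.η X
  act-q X = begin
    (q X ∘ (T.mult.η X ∘ T.F₁ (s X))) ∘ T.F₁ (q X)
      ≈⟨ pullʳ (pullʳ (≈-sym T.homomorphism)) ⟩
    q X ∘ (T.mult.η X ∘ T.F₁ (s X ∘ q X))
      ≈⟨ separate X _ _ (λ c → begin
        k c ∘ (T.mult.η X ∘ T.F₁ (s X ∘ q X))
          ≈⟨ extendʳ (≈-trans (mult-compat c) (≈-sym assoc)) ⟩
        (k c ∘ T.mult.η X) ∘ (T.F₁ (k c) ∘ T.F₁ (s X ∘ q X))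
          ≈⟨ refl⟩∘⟨ ≈-trans (≈-sym T.homomorphism) (T.F-resp-≈ (absorb X c)) ⟩
        (k c ∘ T.mult.η X) ∘ T.F₁ (k c)
          ≈⟨ assoc ⟩
        k c ∘ (T.mult.η X ∘ T.F₁ (k c))
          ≈⟨ mult-compat c ⟨
        k c ∘ T.mult.η X ∎) ⟩
    q X ∘ T.mult.η X ∎

  -- Precomposing with `S.F₁ i (q X)` moves the claim to the free algebra, where `identifies` gives
  -- it for every congruence at once.
  act-equational : ∀ X → Equational (act X)
  act-equational X i = cancel-split (map-split (S.F i) (retract X)) (begin
    (act X ∘ φ.η i _) ∘ S.F₁ i (q X)   ≈⟨ pullʳ (φ.commute i (q X)) ⟩
    act X ∘ (T.F₁ (q X) ∘ φ.η i _)     ≈⟨ extendʳ (act-q X) ⟩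
    q X ∘ (T.mult.η X ∘ φ.η i _)       ≈⟨ separate X _ _ (λ c → identifies c i) ⟩
    q X ∘ (T.mult.η X ∘ ψ.η i _)       ≈⟨ extendʳ (act-q X) ⟨
    act X ∘ (T.F₁ (q X) ∘ ψ.η i _)     ≈⟨ pullʳ (ψ.commute i (q X)) ⟨
    (act X ∘ ψ.η i _) ∘ S.F₁ i (q X)   ∎)

  -- Associativity is inherited from the free algebra along `q X`. It makes `act X` a homomorphism
  -- out of the free algebra on `R₀ X`, so that `hom-absorb` applies to it and yields `m`.
  act-assoc : ∀ X → act X ∘ T.mult.η (R₀ X) ≈ act X ∘ T.F₁ (act X)
  act-assoc X = cancel-split (map-split T.F (map-split T.F (retract X))) (begin
    (act X ∘ T.mult.η _) ∘ T.F₁ (T.F₁ (q X))    ≈⟨ pullʳ (T.mult.commute (q X)) ⟩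
    act X ∘ (T.F₁ (q X) ∘ T.mult.η _)           ≈⟨ extendʳ (act-q X) ⟩
    q X ∘ (T.mult.η X ∘ T.mult.η _)             ≈⟨ refl⟩∘⟨ T.assoc′ X ⟨
    q X ∘ (T.mult.η X ∘ T.F₁ (T.mult.η X))      ≈⟨ extendʳ (act-q X) ⟨
    act X ∘ (T.F₁ (q X) ∘ T.F₁ (T.mult.η X))    ≈⟨ refl⟩∘⟨ T.homomorphism ⟨
    act X ∘ T.F₁ (q X ∘ T.mult.η X)             ≈⟨ refl⟩∘⟨ T.F-resp-≈ (act-q X) ⟨
    act X ∘ T.F₁ (act X ∘ T.F₁ (q X))           ≈⟨ refl⟩∘⟨ T.homomorphism ⟩
    act X ∘ (T.F₁ (act X) ∘ T.F₁ (T.F₁ (q X)))  ≈⟨ assoc ⟨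
    (act X ∘ T.F₁ (act X)) ∘ T.F₁ (T.F₁ (q X))  ∎)

  q-map-hom : ∀ {X Y} (f : X ⇒ Y) →
              (q Y ∘ T.F₁ f) ∘ T.mult.η X ≈ act Y ∘ T.F₁ (q Y ∘ T.F₁ f)
  q-map-hom {X} {Y} f = begin
    (q Y ∘ T.F₁ f) ∘ T.mult.η X              ≈⟨ pullʳ (≈-sym (T.mult.commute f)) ⟩
    q Y ∘ (T.mult.η Y ∘ T.F₁ (T.F₁ f))       ≈⟨ extendʳ (act-q Y) ⟨
    act Y ∘ (T.F₁ (q Y) ∘ T.F₁ (T.F₁ f))     ≈⟨ refl⟩∘⟨ T.homomorphism ⟨
    act Y ∘ T.F₁ (q Y ∘ T.F₁ f)              ∎

  quotient : PointwiseQuotient T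
  quotient = record
    { R₀ = R₀
    ; q = q
    ; s = s
    ; retract = retract
    -- `R₁` and `m` are homomorphisms out of free algebras, precomposed with a section; `hom-absorb`
    -- recovers these homomorphisms after `q`.
    ; R₁ = λ {X} {Y} f → (q Y ∘ T.F₁ f) ∘ s X
    ; R₁-q = λ {X} {Y} f →
        ≈-trans assoc (hom-absorb (act Y) (q Y ∘ T.F₁ f) (q-map-hom f) (act-equational Y))
    ; m = λ X → act X ∘ s (R₀ X)
    ; m-q = λ X → begin
        (act X ∘ s (R₀ X)) ∘ (q (R₀ X) ∘ T.F₁ (q X))
          ≈⟨ pullʳ (≈-sym assoc) ⟩
        act X ∘ ((s (R₀ X) ∘ q (R₀ X)) ∘ T.F₁ (q X))
          ≈⟨ pullˡ (hom-absorb (act X) (act X) (act-assoc X) (act-equational X)) ⟩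
        act X ∘ T.F₁ (q X)
          ≈⟨ act-q X ⟩
        q X ∘ T.mult.η X ∎ }

  open PointwiseQuotient quotient using (quotientMonad; projection; factorization; q-cancel)

  -- `act-equational` concerns components at `R₀ X`. The unit law of `T` and naturality at
  -- `q X ∘ T.unit.η X` transfer it to the components at `X`.
  projection-equality : ∀ i X → q X ∘ φ.η i X ≈ q X ∘ ψ.η i X
  projection-equality i X = begin
    q X ∘ φ.η i X                                     ≈⟨ via-act φ ⟩
    act X ∘ (φ.η i _ ∘ S.F₁ i (q X ∘ T.unit.η X))     ≈⟨ extendʳ (act-equational X i) ⟩
    act X ∘ (ψ.η i _ ∘ S.F₁ i (q X ∘ T.unit.η X))     ≈⟨ via-act ψ ⟨
    q X ∘ ψ.η i X                                     ∎
    where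
    via-act : (χ : ∀ i → MonadMorphism (S i) T) → let χᵢ = MonadMorphism.η (χ i) in
              q X ∘ χᵢ X ≈ act X ∘ (χᵢ (R₀ X) ∘ S.F₁ i (q X ∘ T.unit.η X))
    via-act χ = begin
      q X ∘ χ.η X                                              ≈⟨ refl⟩∘⟨ identityˡ ⟨
      q X ∘ (id ∘ χ.η X)                                       ≈⟨ refl⟩∘⟨ (T.identityˡ′ X ⟩∘⟨refl) ⟨
      q X ∘ ((T.mult.η X ∘ T.F₁ (T.unit.η X)) ∘ χ.η X)         ≈⟨ refl⟩∘⟨ assoc ⟩
      q X ∘ (T.mult.η X ∘ (T.F₁ (T.unit.η X) ∘ χ.η X))         ≈⟨ extendʳ (act-q X) ⟨
      act X ∘ (T.F₁ (q X) ∘ (T.F₁ (T.unit.η X) ∘ χ.η X))       ≈⟨ refl⟩∘⟨ pullˡ (≈-sym T.homomorphism) ⟩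
      act X ∘ (T.F₁ (q X ∘ T.unit.η X) ∘ χ.η X)                ≈⟨ refl⟩∘⟨ χ.commute _ ⟨
      act X ∘ (χ.η (R₀ X) ∘ S.F₁ i (q X ∘ T.unit.η X))         ∎
      where module χ = MonadMorphism (χ i)

  module _ {U : Monad A} (τ : MonadMorphism T U) where
    private
      module U = Monad U
      module τ = MonadMorphism τ

    module _ (eq : ∀ i X → τ.η X ∘ φ.η i X ≈ τ.η X ∘ ψ.η i X) where

      -- U X is a T-algebra via τ, and τ X is a homomorphism to it.
      τ-absorb : ∀ X → τ.η X ∘ (s X ∘ q X) ≈ τ.η X
      τ-absorb X = hom-absorb (U.mult.η X ∘ τ.η (U.F₀ X)) (τ.η X)
        (begin
          τ.η X ∘ T.mult.η X                               ≈⟨ τ.mult-law X ⟩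
          U.mult.η X ∘ (U.F₁ (τ.η X) ∘ τ.η _)              ≈⟨ pullʳ (τ.commute (τ.η X)) ⟨
          (U.mult.η X ∘ τ.η (U.F₀ X)) ∘ T.F₁ (τ.η X)       ∎)
        (λ i → ≈-trans (pullʳ (eq i (U.F₀ X))) (≈-sym assoc))

      mediating-q : ∀ X → (τ.η X ∘ s X) ∘ q X ≈ τ.η X
      mediating-q X = ≈-trans assoc (τ-absorb X)

      mediating : MonadMorphism quotientMonad U
      mediating = factorization τ (λ X → τ.η X ∘ s X) mediating-q

  monadJointCoequalizer : JointCoequalizer (MonadCat A) φ ψ
  monadJointCoequalizer = record
    { obj = quotientMonad
    ; arr = projection
    ; equality = projection-equality
    ; coequalize = mediating
    ; universal = mediating-q
    ; unique = λ τ eq u p X → q-cancel (≈-trans (p X) (≈-sym (mediating-q τ eq X))) }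

-- Colimits of diagrams with a weakly terminal object.

-- All parallel pairs into j are identified, not just those arising from the diagram's arrows and a
-- chosen x → j: comparing with id at j makes the leg at j the quotient map itself.
module _ {o ℓ e o′ ℓ′ e′} {J : Category o′ ℓ′ e′} {C : Category o ℓ e} (D : Functor J C)
  {j : Category.Obj J} (wt : WeaklyTerminal J j) where
  private
    module J = Category J
    module D = Functor D
    open Category C
    open Composition C

  ParallelPair : Set (o′ ⊔ ℓ′)
  ParallelPair = Σ J.Obj λ x → J [ x , j ] × J [ x , j ]

  weaklyTerminal⇒colimit :
    JointCoequalizer C {I = ParallelPair} (λ (_ , f , _) → D.F₁ f) (λ (_ , _ , g) → D.F₁ g) →
    Colimit D
  weaklyTerminal⇒colimit Q = record
    { cocone = record
        { N = obj
        ; ψ = λ x → arr ∘ D.F₁ (wt x)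
        -- Following `f` by the chosen arrow into `j` gives an arrow parallel to the one chosen at
        -- the source of `f`.
        ; commute = λ f → ≈-trans (pullʳ (≈-sym D.homomorphism)) (equality (_ , _ , _)) }
    ; rep = λ K → coequalize (Cocone.ψ K j) (K-eq K)
    ; rep-commute = λ K x →
        ≈-trans (pullˡ (universal (Cocone.ψ K j) (K-eq K))) (Cocone.commute K (wt x))
    ; rep-unique = λ K u p → unique (Cocone.ψ K j) (K-eq K) u (≈-trans
        (refl⟩∘⟨ ≈-sym (≈-trans (equality (j , wt j , J.id)) (≈-trans (refl⟩∘⟨ D.identity) identityʳ)))
        (p j)) }
    where
    open JointCoequalizer Q
    K-eq : (K : Cocone D) (p : ParallelPair) → let (_ , f , g) = p in
           Cocone.ψ K j ∘ D.F₁ f ≈ Cocone.ψ K j ∘ D.F₁ g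
    K-eq K (_ , f , g) = ≈-trans (Cocone.commute K f) (≈-sym (Cocone.commute K g))

-- Colimits and coequalizers in the category of monads.

theorem3p9 : ∀ {o ℓ e : Level} (A : Category o ℓ e) →
    (∀ (J : Category (ℓ ⊔ e) (ℓ ⊔ e) (ℓ ⊔ e)) (F : Functor J A) → Limit F) →
    (∀ (J : Category (ℓ ⊔ e) (ℓ ⊔ e) (ℓ ⊔ e)) (F : Functor J A) → Colimit F) →
    StableMonos (ℓ ⊔ e) A →
    (∀ {X Y : Category.Obj A} (f : A [ X , Y ]) → Epi A f → SplitEpi A f) →
    ((J : Category (ℓ ⊔ e) (ℓ ⊔ e) (ℓ ⊔ e)) (D : Functor J (MonadCat A)) →
    (j : Category.Obj J) → WeaklyTerminal J j → Colimit D)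
    ×
    (∀ {S T : Monad A} (f g : MonadCat A [ S , T ]) → Coequalizer (MonadCat A) f g)
theorem3p9 {ℓ = ℓ} {e} A _ colimits _ split =
  (λ J D j wt → weaklyTerminal⇒colimit D wt (monadJointCoequalizer _ _)) ,
  -- A single parallel pair is a family indexed by `⊤`.
  (λ f g → let open JointCoequalizer (monadJointCoequalizer {I = ⊤} (λ _ → f) (λ _ → g)) in record
    { obj = obj
    ; arr = arr
    ; equality = equality tt
    ; coequalize = λ h eq → coequalize h (λ _ → eq)
    ; universal = λ h eq → universal h (λ _ → eq)
    ; unique = λ h eq → unique h (λ _ → eq) })
  where
  open JointCoequalizerShape using (diagram; colimit⇒jointCoequalizer)
  coeq : ∀ {I : Set (ℓ ⊔ e)} {Z : I → Category.Obj A} {X} (g h : ∀ i → A [ Z i , X ]) →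
         JointCoequalizer A g h
  coeq {I} g h = colimit⇒jointCoequalizer I A g h (colimits _ (diagram I A g h))
  -- At this level the absorbed endomorphisms still form a small index set, and joint images may be
  -- indexed by congruences.
  open Images {a = ℓ ⊔ e} A coeq split using (jointImage)
  open MonadCoequalizers A jointImage using (monadJointCoequalizer)
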